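{- Let $\alpha,\beta\in\mathbb{R}$ and let $n\ge 2$ be an integer with $T_1(\alpha,\beta,n)\ne 0$. Then $$\begin{aligned} F_{n+1}^{(\alpha,\beta)}(x)={}&\left(\frac{2T_2(\alpha,\beta,n)}{T_1(\alpha,\beta,n)}x+\frac{2(n-1)T_5(\alpha,\beta,n)}{(n+1)T_1(\alpha,\beta,n)}\right)F_n^{(\alpha,\beta)}(x)\\ &-\frac{(n-2)T_3(\alpha,\beta,n)}{(n+1)T_1(\alpha,\beta,n)}(x-1)^2F_{n-1}^{(\alpha,\beta)}(x)\\ &-\frac{2T_4(\alpha,\beta,n)}{n(n+1)T_1(\alpha,\beta,n)}x(x-1)\bigl(F_n^{(\alpha,\beta)}(x)\bigr)', \end{aligned}$$ where the prime denotes the derivative with respect to $x$, and where for $n=2$ the term containing $F_{n-1}^{(\alpha,\beta)}(x)$ is read as $0$ because of the factor $n-2$.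
   Context: For $n\ge 0$ let $$N_{A_n}(x)=\frac{1}{n+1}\sum_{k=0}^{n}\binom{n+1}{k}\binom{n+1}{k+1}x^k,\qquad N_{B_n}(x)=\sum_{k=0}^n\binom{n}{k}^2x^k,$$ and for $n\ge 2$ let $$F_n^{(\alpha,\beta)}(x)=\alpha N_{B_n}(x)+\beta\, n x\, N_{A_{n-2}}(x).$$ Further let $$\begin{aligned} T_1(\alpha,\beta,n)&=(4n-2)\alpha+n\beta,\\ T_2(\alpha,\beta,n)&=(4n-1)\alpha+n\beta,\\ T_3(\alpha,\beta,n)&=4n\alpha+(n+1)\beta,\\ T_4(\alpha,\beta,n)&=6n\alpha+(n+1)\beta,\\ T_5(\alpha,\beta,n)&=(4n+1)\alpha+(n+1)\beta. \end{aligned}$$ -}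

module Defs where

open import Algebra.Bundles using (CommutativeRing)
open import Data.Integer.Base using (+_)
open import Data.List.Base using (List; []; _∷_; map; applyUpTo)
open import Data.Nat.Base as ℕ using (ℕ; zero; suc; z≤n; s≤s)
open import Data.Nat.Combinatorics using (_C_)
import Data.Nat.Properties as ℕₚ
open import Data.Product.Base using (∃-syntax; _,_; proj₁; proj₂)
open import Data.Rational.Base as ℚ using (ℚ; 0ℚ; 1ℚ; ½; ∣_∣)
import Data.Rational.Properties as ℚₚ
open import Level using (0ℓ)
open import Relation.Binary.PropositionalEquality
open import Relation.Nullary using (yes; no; contradiction)

private
  module Estimates where
    open import Data.Rational.Base using (_+_; _*_; -_; _-_; _<_; _≤_; NonZero; Positive; NonNegative)
    open import Data.Rational.Solver using (module +-*-Solver)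
    open +-*-Solver using (solve; _:=_; _:+_; _:*_; :-_; _:-_)
    open ℚₚ.≤-Reasoning

    inv : ℚ → ℚ
    inv q with q ℚₚ.≟ 0ℚ
    ... | yes _  = 0ℚ
    ... | no q≢0 = (ℚ.1/ q) {{ℚ.≢-nonZero q≢0}}

    inv-inverse : ∀ q → q ≢ 0ℚ → q * inv q ≡ 1ℚ
    inv-inverse q q≢0 with q ℚₚ.≟ 0ℚ
    ... | yes q≡0 = contradiction q≡0 q≢0
    ... | no q≢0′ = ℚₚ.*-inverseʳ q {{ℚ.≢-nonZero q≢0′}}

    0<½ : 0ℚ < ½
    0<½ = ℚₚ.positive⁻¹ ½

    0<+ : ∀ {p q} → 0ℚ < p → 0ℚ < q → 0ℚ < p + q
    0<+ = ℚₚ.+-mono-<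

    0<* : ∀ {p q} → 0ℚ < p → 0ℚ < q → 0ℚ < p * q
    0<* {p} {q} 0<p 0<q = begin-strict
      0ℚ      ≡⟨ ℚₚ.*-zeroʳ p ⟨
      p * 0ℚ  <⟨ ℚₚ.*-monoʳ-<-pos p {{ℚ.positive 0<p}} 0<q ⟩
      p * q   ∎

    halves : ∀ ε → ½ * ε + ½ * ε ≡ ε
    halves ε = trans (sym (ℚₚ.*-distribʳ-+ ε ½ ½)) (ℚₚ.*-identityˡ ε)

    ∣p-p∣<ε : ∀ p {ε} → 0ℚ < ε → ∣ p - p ∣ < ε
    ∣p-p∣<ε p {ε} 0<ε = subst (λ d → ∣ d ∣ < ε) (sym (ℚₚ.+-inverseʳ p)) 0<ε

    ∣p-q∣≡∣q-p∣ : ∀ p q → ∣ p - q ∣ ≡ ∣ q - p ∣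
    ∣p-q∣≡∣q-p∣ p q = trans
      (cong ∣_∣ (solve 2 (λ p q → p :- q := :- (q :- p)) refl p q))
      (ℚₚ.∣-p∣≡∣p∣ (q - p))

    sum-close : ∀ p q r s {ε} → ∣ p - r ∣ < ½ * ε → ∣ q - s ∣ < ½ * ε →
                ∣ (p + q) - (r + s) ∣ < ε
    sum-close p q r s {ε} pr qs = begin-strict
      ∣ (p + q) - (r + s) ∣   ≡⟨ cong ∣_∣ (solve 4 (λ p q r s →
        (p :+ q) :- (r :+ s) := (p :- r) :+ (q :- s)) refl p q r s) ⟩
      ∣ (p - r) + (q - s) ∣   ≤⟨ ℚₚ.∣p+q∣≤∣p∣+∣q∣ (p - r) (q - s) ⟩
      ∣ p - r ∣ + ∣ q - s ∣   <⟨ ℚₚ.+-mono-< pr qs ⟩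
      ½ * ε + ½ * ε           ≡⟨ halves ε ⟩
      ε                       ∎

    trans-close : ∀ p q r {ε} → ∣ p - q ∣ < ½ * ε → ∣ q - r ∣ < ½ * ε →
                  ∣ p - r ∣ < ε
    trans-close p q r {ε} pq qr = subst (λ d → ∣ d ∣ < ε)
      (solve 3 (λ p q r → (p :+ q) :- (q :+ r) := p :- r) refl p q r)
      (sum-close p q q r pq qr)

    neg-close : ∀ p q {ε} → ∣ p - q ∣ < ε → ∣ (- p) - (- q) ∣ < ε
    neg-close p q {ε} pq = subst (_< ε)
      (trans (sym (ℚₚ.∣-p∣≡∣p∣ (p - q)))
             (cong ∣_∣ (solve 2 (λ p q → :- (p :- q) := (:- p) :- (:- q)) refl p q)))
      pq

    bounded : ∀ p q → ∣ p - q ∣ < 1ℚ → ∣ p ∣ ≤ ∣ q ∣ + 1ℚ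
    bounded p q pq = begin
      ∣ p ∣              ≡⟨ cong ∣_∣ (solve 2 (λ p q → p := q :+ (p :- q)) refl p q) ⟩
      ∣ q + (p - q) ∣    ≤⟨ ℚₚ.∣p+q∣≤∣p∣+∣q∣ q (p - q) ⟩
      ∣ q ∣ + ∣ p - q ∣  ≤⟨ ℚₚ.+-monoʳ-≤ ∣ q ∣ (ℚₚ.<⇒≤ pq) ⟩
      ∣ q ∣ + 1ℚ         ∎

    0<∣p∣+1 : ∀ p → 0ℚ < ∣ p ∣ + 1ℚ
    0<∣p∣+1 p = ℚₚ.+-mono-≤-< (ℚₚ.0≤∣p∣ p) (ℚₚ.positive⁻¹ 1ℚ)

    module _ {A : ℚ} (0<A : 0ℚ < A) where
      A≢0 : A ≢ 0ℚ
      A≢0 A≡0 = ℚₚ.<-irrefl (sym A≡0) 0<A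

      shrink : ℚ → ℚ
      shrink ε = inv A * ε

      A*shrink : ∀ ε → A * shrink ε ≡ ε
      A*shrink ε = trans (sym (ℚₚ.*-assoc A (inv A) ε))
        (trans (cong (_* ε) (inv-inverse A A≢0)) (ℚₚ.*-identityˡ ε))

      0<shrink : ∀ {ε} → 0ℚ < ε → 0ℚ < shrink ε
      0<shrink {ε} 0<ε = ℚₚ.*-cancelˡ-<-nonNeg A {{ℚ.nonNegative (ℚₚ.<⇒≤ 0<A)}}
        (subst₂ _<_ (sym (ℚₚ.*-zeroʳ A)) (sym (A*shrink ε)) 0<ε)

    product-close : ∀ p q r s {A D δ} → 0ℚ < A → 0ℚ < D →
                    ∣ p ∣ ≤ A → ∣ s ∣ ≤ D → ∣ p - r ∣ < δ → ∣ q - s ∣ < δ →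
                    ∣ p * q - r * s ∣ < (A + D) * δ
    product-close p q r s {A} {D} {δ} 0<A 0<D pA sD pr qs = begin-strict
      ∣ p * q - r * s ∣                      ≡⟨ cong ∣_∣ (solve 4 (λ p q r s →
        p :* q :- r :* s := p :* (q :- s) :+ (p :- r) :* s) refl p q r s) ⟩
      ∣ p * (q - s) + (p - r) * s ∣          ≤⟨ ℚₚ.∣p+q∣≤∣p∣+∣q∣ (p * (q - s)) ((p - r) * s) ⟩
      ∣ p * (q - s) ∣ + ∣ (p - r) * s ∣      ≡⟨ cong₂ _+_ (ℚₚ.∣p*q∣≡∣p∣*∣q∣ p (q - s)) (ℚₚ.∣p*q∣≡∣p∣*∣q∣ (p - r) s) ⟩
      ∣ p ∣ * ∣ q - s ∣ + ∣ p - r ∣ * ∣ s ∣  ≤⟨ ℚₚ.+-mono-≤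
        (ℚₚ.*-monoʳ-≤-nonNeg ∣ q - s ∣ {{ℚₚ.∣-∣-nonNeg (q - s)}} pA)
        (ℚₚ.*-monoˡ-≤-nonNeg ∣ p - r ∣ {{ℚₚ.∣-∣-nonNeg (p - r)}} sD) ⟩
      A * ∣ q - s ∣ + ∣ p - r ∣ * D          <⟨ ℚₚ.+-mono-<
        (ℚₚ.*-monoʳ-<-pos A {{ℚ.positive 0<A}} qs)
        (ℚₚ.*-monoˡ-<-pos D {{ℚ.positive 0<D}} pr) ⟩
      A * δ + δ * D                          ≡⟨ solve 3 (λ A D δ →
        A :* δ :+ δ :* D := (A :+ D) :* δ) refl A D δ ⟩
      (A + D) * δ                            ∎

    c≤∣p∣⇒p≢0 : ∀ {c} p → 0ℚ < c → c ≤ ∣ p ∣ → p ≢ 0ℚ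
    c≤∣p∣⇒p≢0 p 0<c cp refl = ℚₚ.<-irrefl refl (ℚₚ.<-≤-trans 0<c cp)

    *-mono-≤∣∣ : ∀ {c d} p q → 0ℚ < c → 0ℚ < d → c ≤ ∣ p ∣ → d ≤ ∣ q ∣ → c * d ≤ ∣ p * q ∣
    *-mono-≤∣∣ {c} {d} p q 0<c 0<d cp dq = begin
      c * d          ≤⟨ ℚₚ.*-monoˡ-≤-nonNeg c {{ℚ.nonNegative (ℚₚ.<⇒≤ 0<c)}} dq ⟩
      c * ∣ q ∣      ≤⟨ ℚₚ.*-monoʳ-≤-nonNeg ∣ q ∣ {{ℚₚ.∣-∣-nonNeg q}} cp ⟩
      ∣ p ∣ * ∣ q ∣  ≡⟨ ℚₚ.∣p*q∣≡∣p∣*∣q∣ p q ⟨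
      ∣ p * q ∣      ∎

    inv-close : ∀ {c ε} p q → 0ℚ < c → c ≤ ∣ p ∣ → c ≤ ∣ q ∣ →
                ∣ p - q ∣ < (c * c) * ε → ∣ inv p - inv q ∣ < ε
    inv-close {c} {ε} p q 0<c cp cq pq =
      ℚₚ.*-cancelˡ-<-nonNeg (c * c) {{ℚ.nonNegative (ℚₚ.<⇒≤ (0<* 0<c 0<c))}} (begin-strict
        (c * c) * ∣ inv p - inv q ∣      ≤⟨ ℚₚ.*-monoʳ-≤-nonNeg ∣ inv p - inv q ∣ {{ℚₚ.∣-∣-nonNeg (inv p - inv q)}}
                                              (*-mono-≤∣∣ p q 0<c 0<c cp cq) ⟩
        ∣ p * q ∣ * ∣ inv p - inv q ∣    ≡⟨ ℚₚ.∣p*q∣≡∣p∣*∣q∣ (p * q) (inv p - inv q) ⟨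
        ∣ p * q * (inv p - inv q) ∣      ≡⟨ cong ∣_∣ (solve 4 (λ p q u v →
          p :* q :* (u :- v) := (p :* u) :* q :- (q :* v) :* p) refl p q (inv p) (inv q)) ⟩
        ∣ p * inv p * q - q * inv q * p ∣  ≡⟨ cong ∣_∣ (cong₂ (λ u v → u * q - v * p)
                                              (inv-inverse p (c≤∣p∣⇒p≢0 p 0<c cp))
                                              (inv-inverse q (c≤∣p∣⇒p≢0 q 0<c cq))) ⟩
        ∣ 1ℚ * q - 1ℚ * p ∣              ≡⟨ cong₂ (λ u v → ∣ u - v ∣) (ℚₚ.*-identityˡ q) (ℚₚ.*-identityˡ p) ⟩
        ∣ q - p ∣                        ≡⟨ ∣p-q∣≡∣q-p∣ q p ⟩
        ∣ p - q ∣                        <⟨ pq ⟩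
        (c * c) * ε                      ∎)

  open Estimates

  module _ {a b : ℕ} where
    left : ∀ {n} → a ℕ.⊔ b ℕ.≤ n → a ℕ.≤ n
    left = ℕₚ.≤-trans (ℕₚ.m≤m⊔n a b)

    right : ∀ {n} → a ℕ.⊔ b ℕ.≤ n → b ℕ.≤ n
    right = ℕₚ.≤-trans (ℕₚ.m≤n⊔m a b)

infix  8 -_ ↑_ _⁻¹
infixl 7 _*_ _/_
infixl 6 _+_ _-_
infix  4 _≈_

-- Cauchy sequences of rationals; equality of reals is _≈_, not _≡_.
record ℝ : Set where
  no-eta-equality
  field
    seq    : ℕ → ℚ
    cauchy : ∀ ε → 0ℚ ℚ.< ε →
             ∃[ N ] (∀ m n → N ℕ.≤ m → N ℕ.≤ n → ∣ seq m ℚ.- seq n ∣ ℚ.< ε)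
open ℝ public

record _≈_ (x y : ℝ) : Set where
  no-eta-equality
  constructor mk≈
  field
    null : ∀ ε → 0ℚ ℚ.< ε →
           ∃[ N ] (∀ n → N ℕ.≤ n → ∣ seq x n ℚ.- seq y n ∣ ℚ.< ε)
open _≈_ public

fromℚ : ℚ → ℝ
fromℚ q .seq    _       = q
fromℚ q .cauchy ε 0<ε = 0 , λ _ _ _ _ → ∣p-p∣<ε q 0<ε

↑_ : ℕ → ℝ
(↑ n) .seq    = fromℚ (+ n ℚ./ 1) .seq
(↑ n) .cauchy = fromℚ (+ n ℚ./ 1) .cauchy

0ℝ 1ℝ : ℝ
0ℝ = fromℚ 0ℚ
1ℝ = fromℚ 1ℚ

private
  bound : ∀ x → ∃[ B ] ∃[ N ] (∀ n → N ℕ.≤ n → ∣ seq x n ∣ ℚ.≤ ∣ B ∣ ℚ.+ 1ℚ)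
  bound x = let N , c = cauchy x 1ℚ (ℚₚ.positive⁻¹ 1ℚ) in
    seq x N , N , λ n N≤n → bounded (seq x n) (seq x N) (c n N N≤n ℕₚ.≤-refl)

_+_ : ℝ → ℝ → ℝ
(x + y) .seq n = seq x n ℚ.+ seq y n
(x + y) .cauchy ε 0<ε =
  let M , cx = cauchy x (½ ℚ.* ε) (0<* 0<½ 0<ε)
      N , cy = cauchy y (½ ℚ.* ε) (0<* 0<½ 0<ε)
  in M ℕ.⊔ N , λ m n Km Kn →
       sum-close (seq x m) (seq y m) (seq x n) (seq y n)
         (cx m n (left {M} {N} Km) (left {M} {N} Kn)) (cy m n (right {M} {N} Km) (right {M} {N} Kn))

-_ : ℝ → ℝ
(- x) .seq n = ℚ.- seq x n
(- x) .cauchy ε 0<ε = let N , c = cauchy x ε 0<ε in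
  N , λ m n Nm Nn → neg-close (seq x m) (seq x n) (c m n Nm Nn)

_-_ : ℝ → ℝ → ℝ
x - y = x + (- y)

_*_ : ℝ → ℝ → ℝ
(x * y) .seq n = seq x n ℚ.* seq y n
(x * y) .cauchy ε 0<ε =
  let A , M₁ , bx = bound x
      D , N₁ , by = bound y
      0<A = 0<∣p∣+1 A
      0<D = 0<∣p∣+1 D
      0<S = 0<+ 0<A 0<D
      δ   = shrink 0<S ε
      0<δ = 0<shrink 0<S 0<ε
      M₂ , cx = cauchy x δ 0<δ
      N₂ , cy = cauchy y δ 0<δ
      M = M₁ ℕ.⊔ M₂
      N = N₁ ℕ.⊔ N₂
  in M ℕ.⊔ N , λ m n Km Kn →
       let Mm = left {M} {N} Km ; Mn = left {M} {N} Kn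
           Nm = right {M} {N} Km ; Nn = right {M} {N} Kn
       in subst (_ ℚ.<_) (A*shrink 0<S ε)
            (product-close (seq x m) (seq y m) (seq x n) (seq y n) 0<A 0<D
              (bx m (left {M₁} {M₂} Mm)) (by n (left {N₁} {N₂} Nn))
              (cx m n (right {M₁} {M₂} Mm) (right {M₁} {M₂} Mn))
              (cy m n (right {N₁} {N₂} Nm) (right {N₁} {N₂} Nn)))

-- Being nonzero, in the form that provides an inverse: the sequence is
-- eventually bounded away from 0.  Classically this is ¬ (x ≈ 0ℝ).
record _≠0 (x : ℝ) : Set where
  no-eta-equality
  field
    gap   : ℚ
    0<gap : 0ℚ ℚ.< gap
    from  : ℕ
    apart : ∀ n → from ℕ.≤ n → gap ℚ.≤ ∣ seq x n ∣
open _≠0 public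

_⁻¹ : (x : ℝ) → {{x ≠0}} → ℝ
(x ⁻¹) .seq n = inv (seq x n)
(_⁻¹ x {{x≠0}}) .cauchy ε 0<ε =
  let c , M = gap x≠0 , from x≠0
      0<c = 0<gap x≠0
      N , cx = cauchy x (c ℚ.* c ℚ.* ε) (0<* (0<* 0<c 0<c) 0<ε)
  in M ℕ.⊔ N , λ m n Km Kn →
       inv-close (seq x m) (seq x n) 0<c
         (apart x≠0 m (left {M} {N} Km)) (apart x≠0 n (left {M} {N} Kn))
         (cx m n (right {M} {N} Km) (right {M} {N} Kn))

_/_ : ℝ → (y : ℝ) → {{y ≠0}} → ℝ
x / y = x * y ⁻¹

instance
  *-≠0 : ∀ {x y} → {{x ≠0}} → {{y ≠0}} → (x * y) ≠0
  *-≠0 {{p}} {{q}} .gap   = gap p ℚ.* gap q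
  *-≠0 {{p}} {{q}} .0<gap = 0<* (0<gap p) (0<gap q)
  *-≠0 {{p}} {{q}} .from  = from p ℕ.⊔ from q
  *-≠0 {x} {y} {{p}} {{q}} .apart n K =
    *-mono-≤∣∣ (seq x n) (seq y n) (0<gap p) (0<gap q)
      (apart p n (left {from p} {from q} K)) (apart q n (right {from p} {from q} K))

  ↑suc-≠0 : ∀ {n} → (↑ suc n) ≠0
  ↑suc-≠0 {n} .gap       = + suc n ℚ./ 1
  ↑suc-≠0 {n} .0<gap     = ℚₚ.positive⁻¹ (+ suc n ℚ./ 1) {{ℚₚ.normalize-pos (suc n) 1}}
  ↑suc-≠0 {n} .from      = 0
  ↑suc-≠0 {n} .apart _ _ = ℚₚ.≤-reflexive
    (sym (ℚₚ.0≤p⇒∣p∣≡p (ℚₚ.<⇒≤ (↑suc-≠0 {n} .0<gap))))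

2≤n⇒↑n≠0 : ∀ {n} → 2 ℕ.≤ n → (↑ n) ≠0
2≤n⇒↑n≠0 (s≤s _) = ↑suc-≠0

pointwise : ∀ {x y} → (∀ n → seq x n ≡ seq y n) → x ≈ y
pointwise {x} {y} eq .null ε 0<ε = 0 , λ n _ →
  subst (λ q → ∣ seq x n ℚ.- q ∣ ℚ.< ε) (eq n) (∣p-p∣<ε (seq x n) 0<ε)

≈-refl : ∀ {x} → x ≈ x
≈-refl = pointwise λ _ → refl

≈-sym : ∀ {x y} → x ≈ y → y ≈ x
≈-sym {x} {y} x≈y .null ε 0<ε = let N , c = null x≈y ε 0<ε in
  N , λ n Nn → subst (ℚ._< ε) (∣p-q∣≡∣q-p∣ (seq x n) (seq y n)) (c n Nn)

≈-trans : ∀ {x y z} → x ≈ y → y ≈ z → x ≈ z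
≈-trans {x} {y} {z} x≈y y≈z .null ε 0<ε =
  let M , c = null x≈y (½ ℚ.* ε) (0<* 0<½ 0<ε)
      N , d = null y≈z (½ ℚ.* ε) (0<* 0<½ 0<ε)
  in M ℕ.⊔ N , λ n K →
       trans-close (seq x n) (seq y n) (seq z n) (c n (left {M} {N} K)) (d n (right {M} {N} K))

+-cong : ∀ {x x′ y y′} → x ≈ x′ → y ≈ y′ → x + y ≈ x′ + y′
+-cong {x} {x′} {y} {y′} p q .null ε 0<ε =
  let M , c = null p (½ ℚ.* ε) (0<* 0<½ 0<ε)
      N , d = null q (½ ℚ.* ε) (0<* 0<½ 0<ε)
  in M ℕ.⊔ N , λ n K →
       sum-close (seq x n) (seq y n) (seq x′ n) (seq y′ n) (c n (left {M} {N} K)) (d n (right {M} {N} K))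

neg-cong : ∀ {x y} → x ≈ y → - x ≈ - y
neg-cong {x} {y} p .null ε 0<ε = let N , c = null p ε 0<ε in
  N , λ n Nn → neg-close (seq x n) (seq y n) (c n Nn)

*-cong : ∀ {x x′ y y′} → x ≈ x′ → y ≈ y′ → x * y ≈ x′ * y′
*-cong {x} {x′} {y} {y′} p q .null ε 0<ε =
  let A , M₁ , bx = bound x
      D , N₁ , by = bound y′
      0<A = 0<∣p∣+1 A
      0<D = 0<∣p∣+1 D
      0<S = 0<+ 0<A 0<D
      δ   = shrink 0<S ε
      0<δ = 0<shrink 0<S 0<ε
      M₂ , c = null p δ 0<δ
      N₂ , d = null q δ 0<δ
      M = M₁ ℕ.⊔ M₂
      N = N₁ ℕ.⊔ N₂
  in M ℕ.⊔ N , λ n K →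
       let Mn = left {M} {N} K ; Nn = right {M} {N} K
       in subst (_ ℚ.<_) (A*shrink 0<S ε)
            (product-close (seq x n) (seq y n) (seq x′ n) (seq y′ n) 0<A 0<D
              (bx n (left {M₁} {M₂} Mn)) (by n (left {N₁} {N₂} Nn))
              (c n (right {M₁} {M₂} Mn)) (d n (right {N₁} {N₂} Nn)))

ℝ-commutativeRing : CommutativeRing 0ℓ 0ℓ
ℝ-commutativeRing = record
  { Carrier = ℝ ; _≈_ = _≈_ ; _+_ = _+_ ; _*_ = _*_ ; -_ = -_ ; 0# = 0ℝ ; 1# = 1ℝ
  ; isCommutativeRing = record
    { isRing = record
      { +-isAbelianGroup = record
        { isGroup = record
          { isMonoid = record
            { isSemigroup = record
              { isMagma = record
                { isEquivalence = record { refl = ≈-refl ; sym = ≈-sym ; trans = ≈-trans }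
                ; ∙-cong = +-cong
                }
              ; assoc = λ x y z → pointwise λ n → ℚₚ.+-assoc (seq x n) (seq y n) (seq z n)
              }
            ; identity = (λ x → pointwise λ n → ℚₚ.+-identityˡ (seq x n))
                       , (λ x → pointwise λ n → ℚₚ.+-identityʳ (seq x n))
            }
          ; inverse = (λ x → pointwise λ n → ℚₚ.+-inverseˡ (seq x n))
                    , (λ x → pointwise λ n → ℚₚ.+-inverseʳ (seq x n))
          ; ⁻¹-cong = neg-cong
          }
        ; comm = λ x y → pointwise λ n → ℚₚ.+-comm (seq x n) (seq y n)
        }
      ; *-cong = *-cong
      ; *-assoc = λ x y z → pointwise λ n → ℚₚ.*-assoc (seq x n) (seq y n) (seq z n)
      ; *-identity = (λ x → pointwise λ n → ℚₚ.*-identityˡ (seq x n))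
                   , (λ x → pointwise λ n → ℚₚ.*-identityʳ (seq x n))
      ; distrib = (λ x y z → pointwise λ n → ℚₚ.*-distribˡ-+ (seq x n) (seq y n) (seq z n))
                , (λ x y z → pointwise λ n → ℚₚ.*-distribʳ-+ (seq x n) (seq y n) (seq z n))
      }
    ; *-comm = λ x y → pointwise λ n → ℚₚ.*-comm (seq x n) (seq y n)
    }
  }

⁻¹-inverseʳ : ∀ x {{_ : x ≠0}} → x * x ⁻¹ ≈ 1ℝ
⁻¹-inverseʳ x {{p}} .null ε 0<ε = from p , λ n K →
  subst (λ q → ∣ q ℚ.- 1ℚ ∣ ℚ.< ε)
    (sym (inv-inverse (seq x n) (c≤∣p∣⇒p≢0 (seq x n) (0<gap p) (apart p n K))))
    (∣p-p∣<ε 1ℚ 0<ε)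

infixr 8 _·_
infixl 7 _*ₚ_
infixl 6 _+ₚ_ _-ₚ_
infix  4 _≋_

-- Coefficient lists, constant term first.  Trailing zeros are allowed, so
-- equality _≋_ compares coefficients.
Poly : Set
Poly = List ℝ

coeff : Poly → ℕ → ℝ
coeff []      _       = 0ℝ
coeff (a ∷ p) zero    = a
coeff (a ∷ p) (suc k) = coeff p k

_≋_ : Poly → Poly → Set
p ≋ q = ∀ k → coeff p k ≈ coeff q k

const : ℝ → Poly
const a = a ∷ []

X : Poly
X = 0ℝ ∷ 1ℝ ∷ []

_+ₚ_ : Poly → Poly → Poly
[]      +ₚ q       = q
(a ∷ p) +ₚ []      = a ∷ p
(a ∷ p) +ₚ (b ∷ q) = (a + b) ∷ (p +ₚ q)

_·_ : ℝ → Poly → Poly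
a · p = map (a *_) p

_-ₚ_ : Poly → Poly → Poly
p -ₚ q = p +ₚ (- 1ℝ) · q

_*ₚ_ : Poly → Poly → Poly
[]      *ₚ q = []
(a ∷ p) *ₚ q = a · q +ₚ (0ℝ ∷ p *ₚ q)

-- The Leibniz rule (a + x p)′ = p + x p′.
deriv : Poly → Poly
deriv []      = []
deriv (a ∷ p) = p +ₚ (0ℝ ∷ deriv p)

-- ∑≤ n c is the polynomial Σ_{k=0}^{n} c(k) x^k.
∑≤ : ℕ → (ℕ → ℝ) → Poly
∑≤ n c = applyUpTo c (suc n)

N-A : ℕ → Poly
N-A n = (1ℝ / ↑ suc n) · ∑≤ n (λ k → ↑ ((suc n C k) ℕ.* (suc n C suc k)))

N-B : ℕ → Poly
N-B n = ∑≤ n (λ k → ↑ ((n C k) ℕ.^ 2))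

-- Defined for n ≥ 2; the zero polynomials at 0 and 1 are filler values.
F : ℝ → ℝ → ℕ → Poly
F α β 0                 = []
F α β 1                 = []
F α β n@(suc (suc n-2)) = α · N-B n +ₚ (β * ↑ n) · (X *ₚ N-A n-2)

T₁ T₂ T₃ T₄ T₅ : ℝ → ℝ → ℕ → ℝ
T₁ α β n = (↑ 4 * ↑ n - ↑ 2) * α + ↑ n * β
T₂ α β n = (↑ 4 * ↑ n - ↑ 1) * α + ↑ n * β
T₃ α β n = ↑ 4 * ↑ n * α + (↑ n + ↑ 1) * β
T₄ α β n = ↑ 6 * ↑ n * α + (↑ n + ↑ 1) * β
T₅ α β n = (↑ 4 * ↑ n + ↑ 1) * α + (↑ n + ↑ 1) * β

{-# OPTIONS --safe #-}

-- The coefficients satisfy n(n-1) [x^k] F_n = C(n,k)² G(n,k), where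
-- G(n,k) = n(n-1) α + k(n-k) β.  Absorption gives (n+1) C(n,k) = (n+1-k) C(n+1,k)
-- and (n+1) C(n,k-1) = k C(n+1,k), for all k.  After clearing denominators,
-- comparing coefficients of x^k therefore makes every term a polynomial in
-- n, k, α, β times C(n+1,k)², and what remains is a polynomial identity.
module Submission where

open import Defs
open import Algebra.Bundles using (CommutativeRing)
import Algebra.Solver.Ring
open import Algebra.Solver.Ring.AlmostCommutativeRing using (fromCommutativeRing; _-Raw-AlmostCommutative⟶_)
open import Data.Integer.Base as ℤ using (ℤ; +_; -[1+_])
import Data.Integer.Properties as ℤₚ
open import Data.List.Base using ([]; _∷_; applyUpTo)
open import Data.Maybe.Base using (Maybe; map)
open import Data.Nat.Base as ℕ using (ℕ; zero; suc; _≤_; _∸_; z≤n; s≤s)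
open import Data.Nat.Combinatorics using (_C_; nCk+nC[k+1]≡[n+1]C[k+1]; k>n⇒nCk≡0)
import Data.Nat.Properties as ℕₚ
import Data.Rational.Base as ℚ
import Data.Rational.Properties as ℚₚ
open import Data.Rational.Unnormalised.Base as ℚᵘ using (mkℚᵘ; *≡*)
import Data.Rational.Unnormalised.Properties as ℚᵘₚ
import Relation.Binary.Reasoning.Setoid
open import Relation.Binary.PropositionalEquality as ≡ using (_≡_; refl; cong; cong₂)
open import Relation.Nullary.Decidable using (dec⇒maybe)

-- Integers inside the reals, and a ring solver with integer coefficients.

/1-homo-+ : ∀ i j → (i ℤ.+ j) ℚ./ 1 ≡ i ℚ./ 1 ℚ.+ j ℚ./ 1
-- Normalised fractions do not reduce for variable `i` and `j`; unnormalised ones with denominator 1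
-- do, up to stray factors 1.
/1-homo-+ i j = ℚₚ.toℚᵘ-injective (begin-equality
  ℚ.toℚᵘ ((i ℤ.+ j) ℚ./ 1)                  ≃⟨ ℚₚ.toℚᵘ-fromℚᵘ (mkℚᵘ (i ℤ.+ j) 0) ⟩
  mkℚᵘ (i ℤ.+ j) 0                          ≃⟨ *≡* (cong (ℤ._* + 1)
    (cong₂ ℤ._+_ (≡.sym (ℤₚ.*-identityʳ i)) (≡.sym (ℤₚ.*-identityʳ j)))) ⟩
  mkℚᵘ i 0 ℚᵘ.+ mkℚᵘ j 0                    ≃⟨ ℚᵘₚ.+-cong (ℚₚ.toℚᵘ-fromℚᵘ (mkℚᵘ i 0)) (ℚₚ.toℚᵘ-fromℚᵘ (mkℚᵘ j 0)) ⟨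
  ℚ.toℚᵘ (i ℚ./ 1) ℚᵘ.+ ℚ.toℚᵘ (j ℚ./ 1)    ≃⟨ ℚₚ.toℚᵘ-homo-+ (i ℚ./ 1) (j ℚ./ 1) ⟨
  ℚ.toℚᵘ (i ℚ./ 1 ℚ.+ j ℚ./ 1)              ∎)
  where open ℚᵘₚ.≤-Reasoning

/1-homo-* : ∀ i j → (i ℤ.* j) ℚ./ 1 ≡ (i ℚ./ 1) ℚ.* (j ℚ./ 1)
/1-homo-* i j = ℚₚ.toℚᵘ-injective (begin-equality
  ℚ.toℚᵘ ((i ℤ.* j) ℚ./ 1)                  ≃⟨ ℚₚ.toℚᵘ-fromℚᵘ (mkℚᵘ (i ℤ.* j) 0) ⟩
  mkℚᵘ i 0 ℚᵘ.* mkℚᵘ j 0                    ≃⟨ ℚᵘₚ.*-cong (ℚₚ.toℚᵘ-fromℚᵘ (mkℚᵘ i 0)) (ℚₚ.toℚᵘ-fromℚᵘ (mkℚᵘ j 0)) ⟨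
  ℚ.toℚᵘ (i ℚ./ 1) ℚᵘ.* ℚ.toℚᵘ (j ℚ./ 1)    ≃⟨ ℚₚ.toℚᵘ-homo-* (i ℚ./ 1) (j ℚ./ 1) ⟨
  ℚ.toℚᵘ ((i ℚ./ 1) ℚ.* (j ℚ./ 1))              ∎)
  where open ℚᵘₚ.≤-Reasoning

/1-homo‿- : ∀ i → (ℤ.- i) ℚ./ 1 ≡ ℚ.- (i ℚ./ 1)
/1-homo‿- i = ℚₚ.toℚᵘ-injective (begin-equality
  ℚ.toℚᵘ ((ℤ.- i) ℚ./ 1)      ≃⟨ ℚₚ.toℚᵘ-fromℚᵘ (mkℚᵘ (ℤ.- i) 0) ⟩
  ℚᵘ.- mkℚᵘ i 0               ≃⟨ ℚᵘₚ.-‿cong (ℚₚ.toℚᵘ-fromℚᵘ (mkℚᵘ i 0)) ⟨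
  ℚᵘ.- ℚ.toℚᵘ (i ℚ./ 1)       ≃⟨ ℚₚ.toℚᵘ-homo‿- (i ℚ./ 1) ⟨
  ℚ.toℚᵘ (ℚ.- (i ℚ./ 1))      ∎)
  where open ℚᵘₚ.≤-Reasoning

-- fromℤ (+ n) is ↑ n by definition, so solver constants match the literals ↑ n.
fromℤ : ℤ → ℝ
fromℤ (+ n)    = ↑ n
fromℤ -[1+ n ] = - ↑ suc n

seq-fromℤ : ∀ i m → seq (fromℤ i) m ≡ i ℚ./ 1
seq-fromℤ (+ n)    m = refl
seq-fromℤ -[1+ n ] m = refl

fromℤ-homo-+ : ∀ i j → fromℤ (i ℤ.+ j) ≈ fromℤ i + fromℤ j
fromℤ-homo-+ i j = pointwise λ m → ≡.trans (seq-fromℤ (i ℤ.+ j) m)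
  (≡.trans (/1-homo-+ i j) (≡.sym (cong₂ ℚ._+_ (seq-fromℤ i m) (seq-fromℤ j m))))

fromℤ-homo-* : ∀ i j → fromℤ (i ℤ.* j) ≈ fromℤ i * fromℤ j
fromℤ-homo-* i j = pointwise λ m → ≡.trans (seq-fromℤ (i ℤ.* j) m)
  (≡.trans (/1-homo-* i j) (≡.sym (cong₂ ℚ._*_ (seq-fromℤ i m) (seq-fromℤ j m))))

fromℤ-homo‿- : ∀ i → fromℤ (ℤ.- i) ≈ - fromℤ i
fromℤ-homo‿- i = pointwise λ m → ≡.trans (seq-fromℤ (ℤ.- i) m)
  (≡.trans (/1-homo‿- i) (≡.sym (cong ℚ.-_ (seq-fromℤ i m))))

0≈ : ↑ 0 ≈ 0ℝ
0≈ = pointwise λ _ → refl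

1≈ : ↑ 1 ≈ 1ℝ
1≈ = pointwise λ _ → refl

-- Equality of Cauchy sequences has no decision procedure, so the solver normalises over ℤ and maps
-- the result into ℝ.
fromℤ-morphism : ℤ.+-*-rawRing -Raw-AlmostCommutative⟶ fromCommutativeRing ℝ-commutativeRing
fromℤ-morphism = record
  { ⟦_⟧ = fromℤ ; +-homo = fromℤ-homo-+ ; *-homo = fromℤ-homo-*
  ; -‿homo = fromℤ-homo‿- ; 0-homo = 0≈ ; 1-homo = 1≈ }

fromℤ-cong : ∀ {i j} → i ≡ j → fromℤ i ≈ fromℤ j
fromℤ-cong refl = ≈-refl

fromℤ-≟ : ∀ i j → Maybe (fromℤ i ≈ fromℤ j)
fromℤ-≟ i j = map fromℤ-cong (dec⇒maybe (i ℤₚ.≟ j))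

open Algebra.Solver.Ring ℤ.+-*-rawRing (fromCommutativeRing ℝ-commutativeRing) fromℤ-morphism
  fromℤ-≟
  using (Polynomial; solve; con; _:=_; _:+_; _:*_; _:-_; :-_)

-- The coefficient weight `G` and solver syntax.

G : ℝ → ℝ → ℝ → ℝ → ℝ
G α β ν κ = ν * (ν - ↑ 1) * α + κ * (ν - κ) * β

module _ {m : ℕ} where
  infixl 8 _:²
  :n_ : ℕ → Polynomial m
  :n j = con (+ j)

  _:² : Polynomial m → Polynomial m
  x :² = x :* x

  -- These copy `G` and the `T` symbol by symbol, so that they evaluate to the originals by
  -- definition and solver goals close with `≈-refl`.
  :G : (α β ν κ : Polynomial m) → Polynomial m
  :G α β ν κ = ν :* (ν :- :n 1) :* α :+ κ :* (ν :- κ) :* β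
  :T₁ :T₂ :T₃ :T₄ :T₅ : (α β n : Polynomial m) → Polynomial m
  :T₁ α β n = (:n 4 :* n :- :n 2) :* α :+ n :* β
  :T₂ α β n = (:n 4 :* n :- :n 1) :* α :+ n :* β
  :T₃ α β n = :n 4 :* n :* α :+ (n :+ :n 1) :* β
  :T₄ α β n = :n 6 :* n :* α :+ (n :+ :n 1) :* β
  :T₅ α β n = (:n 4 :* n :+ :n 1) :* α :+ (n :+ :n 1) :* β

-- Congruence, cancellation and shifts.

open CommutativeRing ℝ-commutativeRing
  using (setoid; zeroˡ; zeroʳ; +-identityˡ; +-identityʳ; *-identityˡ; *-identityʳ; *-assoc)
open Relation.Binary.Reasoning.Setoid setoid

*-congˡ : ∀ {x y z} → y ≈ z → x * y ≈ x * z
*-congˡ = *-cong ≈-refl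

*-congʳ : ∀ {x y z} → y ≈ z → y * x ≈ z * x
*-congʳ y≈z = *-cong y≈z ≈-refl

minus-cong : ∀ {x x′ y y′} → x ≈ x′ → y ≈ y′ → x - y ≈ x′ - y′
minus-cong p q = +-cong p (neg-cong q)

G-cong : ∀ α β {ν ν′ κ κ′} → ν ≈ ν′ → κ ≈ κ′ → G α β ν κ ≈ G α β ν′ κ′
G-cong α β p q = +-cong (*-congʳ (*-cong p (minus-cong p ≈-refl))) (*-congʳ (*-cong q (minus-cong p q)))

*-cancelˡ : ∀ x {{_ : x ≠0}} {y z} → x * y ≈ x * z → y ≈ z
*-cancelˡ x {y} {z} eq = begin
  y              ≈⟨ invert y ⟨
  x ⁻¹ * (x * y) ≈⟨ *-congˡ eq ⟩
  x ⁻¹ * (x * z) ≈⟨ invert z ⟩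
  z              ∎
  where
  invert : ∀ w → x ⁻¹ * (x * w) ≈ w
  invert w = begin
    x ⁻¹ * (x * w) ≈⟨ solve 3 (λ x i w → i :* (x :* w) := (x :* i) :* w) ≈-refl x (x ⁻¹) w ⟩
    (x * x ⁻¹) * w ≈⟨ *-congʳ (⁻¹-inverseʳ x) ⟩
    1ℝ * w         ≈⟨ *-identityˡ w ⟩
    w              ∎

↑-suc : ∀ n → ↑ suc n ≈ ↑ n + ↑ 1
↑-suc n = ≈-trans (fromℤ-homo-+ (+ 1) (+ n)) (solve 2 (λ x y → x :+ y := y :+ x) ≈-refl (↑ 1) (↑ n))

↑-pred : ∀ n → ↑ n ≈ ↑ suc n - ↑ 1
↑-pred n = ≈-sym (≈-trans (minus-cong (↑-suc n) ≈-refl)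
  (solve 1 (λ x → x :+ :n 1 :- :n 1 := x) ≈-refl (↑ n)))

↑-* : ∀ m n → ↑ (m ℕ.* n) ≈ ↑ m * ↑ n
↑-* m n = ≈-trans (fromℤ-cong (ℤₚ.pos-* m n)) (fromℤ-homo-* (+ m) (+ n))

-- Multiplication by x on coefficient sequences; thus sh (bin n) k is C(n, k - 1), zero at k = 0.
sh : (ℕ → ℝ) → ℕ → ℝ
sh f zero    = ↑ 0
sh f (suc k) = f k

sh-cong : ∀ {f g} → (∀ k → f k ≈ g k) → ∀ k → sh f k ≈ sh g k
sh-cong f≈g zero    = ≈-refl
sh-cong f≈g (suc k) = f≈g k

-- Moves a weighted identity from index k to k - 1. The subtraction is real, so at k = 0 the weight
-- is `c` at -1, multiplied by a zero.
sh-weighted : ∀ {a f g} (c : ℝ → ℝ) → (∀ {x y} → x ≈ y → c x ≈ c y) →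
              (∀ k → a * f k ≈ c (↑ k) * g k) →
              ∀ k → a * sh f k ≈ c (↑ k - ↑ 1) * sh g k
sh-weighted {a} c c-cong eq zero    =
  solve 2 (λ a b → a :* :n 0 := b :* :n 0) ≈-refl a (c (↑ 0 - ↑ 1))
sh-weighted {a} {f} {g} c c-cong eq (suc k) =
  ≈-trans (eq k) (*-congʳ (c-cong (↑-pred k)))

-- Coefficients of sums, products and derivatives.

coeff-+ : ∀ p q k → coeff (p +ₚ q) k ≈ coeff p k + coeff q k
coeff-+ []      q       k       = ≈-sym (+-identityˡ _)
coeff-+ (a ∷ p) []      k       = ≈-sym (+-identityʳ _)
coeff-+ (a ∷ p) (b ∷ q) zero    = ≈-refl
coeff-+ (a ∷ p) (b ∷ q) (suc k) = coeff-+ p q k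

coeff-· : ∀ a p k → coeff (a · p) k ≈ a * coeff p k
coeff-· a []      k       = ≈-sym (zeroʳ a)
coeff-· a (b ∷ p) zero    = ≈-refl
coeff-· a (b ∷ p) (suc k) = coeff-· a p k

coeff-minus : ∀ p q k → coeff (p -ₚ q) k ≈ coeff p k - coeff q k
coeff-minus p q k = begin
  coeff (p -ₚ q) k                    ≈⟨ coeff-+ p ((- 1ℝ) · q) k ⟩
  coeff p k + coeff ((- 1ℝ) · q) k    ≈⟨ +-cong ≈-refl (coeff-· (- 1ℝ) q k) ⟩
  coeff p k + (- 1ℝ) * coeff q k      ≈⟨ +-cong ≈-refl (*-congʳ (neg-cong 1≈)) ⟨
  coeff p k + (- ↑ 1) * coeff q k     ≈⟨ solve 2 (λ x y → x :+ (:- :n 1) :* y := x :- y) ≈-refl (coeff p k) (coeff q k) ⟩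
  coeff p k - coeff q k               ∎

coeff-0∷ : ∀ p k → coeff (0ℝ ∷ p) k ≈ sh (coeff p) k
coeff-0∷ p zero    = ≈-sym 0≈
coeff-0∷ p (suc k) = ≈-refl

coeff-∷*ₚ : ∀ a p q k → coeff ((a ∷ p) *ₚ q) k ≈ a * coeff q k + sh (coeff (p *ₚ q)) k
coeff-∷*ₚ a p q k = ≈-trans (coeff-+ (a · q) (0ℝ ∷ p *ₚ q) k)
  (+-cong (coeff-· a q k) (coeff-0∷ (p *ₚ q) k))

coeff-[]*ₚ : ∀ q k → sh (coeff ([] *ₚ q)) k ≈ ↑ 0
coeff-[]*ₚ q zero    = ≈-refl
coeff-[]*ₚ q (suc k) = ≈-sym 0≈

coeff-const*ₚ : ∀ a q k → coeff (const a *ₚ q) k ≈ a * coeff q k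
coeff-const*ₚ a q k = begin
  coeff (const a *ₚ q) k                    ≈⟨ coeff-∷*ₚ a [] q k ⟩
  a * coeff q k + sh (coeff ([] *ₚ q)) k    ≈⟨ +-cong ≈-refl (coeff-[]*ₚ q k) ⟩
  a * coeff q k + ↑ 0                       ≈⟨ solve 1 (λ x → x :+ :n 0 := x) ≈-refl (a * coeff q k) ⟩
  a * coeff q k                             ∎

sh-* : ∀ a f k → sh (λ j → a * f j) k ≈ a * sh f k
sh-* a f zero    = solve 1 (λ a → :n 0 := a :* :n 0) ≈-refl a
sh-* a f (suc k) = ≈-refl

sh-+ : ∀ f g k → sh (λ j → f j + g j) k ≈ sh f k + sh g k
sh-+ f g zero    = solve 0 (:n 0 := :n 0 :+ :n 0) ≈-refl
sh-+ f g (suc k) = ≈-refl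

coeff-linear*ₚ : ∀ a b q k → coeff ((a ∷ b ∷ []) *ₚ q) k ≈ a * coeff q k + b * sh (coeff q) k
coeff-linear*ₚ a b q k = ≈-trans (coeff-∷*ₚ a (const b) q k)
  (+-cong ≈-refl (≈-trans (sh-cong (coeff-const*ₚ b q) k) (sh-* b (coeff q) k)))

coeff-quadratic*ₚ : ∀ a b c q k → coeff ((a ∷ b ∷ c ∷ []) *ₚ q) k ≈
                    a * coeff q k + (b * sh (coeff q) k + c * sh (sh (coeff q)) k)
coeff-quadratic*ₚ a b c q k = ≈-trans (coeff-∷*ₚ a (b ∷ c ∷ []) q k)
  (+-cong ≈-refl (begin
    sh (coeff ((b ∷ c ∷ []) *ₚ q)) k                         ≈⟨ sh-cong (coeff-linear*ₚ b c q) k ⟩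
    sh (λ j → b * coeff q j + c * sh (coeff q) j) k          ≈⟨ sh-+ (λ j → b * coeff q j) (λ j → c * sh (coeff q) j) k ⟩
    sh (λ j → b * coeff q j) k + sh (λ j → c * sh (coeff q) j) k
      ≈⟨ +-cong (sh-* b (coeff q) k) (sh-* c (sh (coeff q)) k) ⟩
    b * sh (coeff q) k + c * sh (sh (coeff q)) k             ∎))

coeff-X*ₚ : ∀ q k → coeff (X *ₚ q) k ≈ sh (coeff q) k
coeff-X*ₚ q k = begin
  coeff (X *ₚ q) k                          ≈⟨ coeff-linear*ₚ 0ℝ 1ℝ q k ⟩
  0ℝ * coeff q k + 1ℝ * sh (coeff q) k      ≈⟨ +-cong (zeroˡ _) (*-identityˡ _) ⟩
  0ℝ + sh (coeff q) k                       ≈⟨ +-identityˡ _ ⟩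
  sh (coeff q) k                            ∎

-- The product associates to the left, so (x-1)² first multiplies out to a list of three
-- coefficients.
coeff-[X-1]²*ₚ : ∀ q k → coeff ((X -ₚ const 1ℝ) *ₚ (X -ₚ const 1ℝ) *ₚ q) k ≈
                 coeff q k - ↑ 2 * sh (coeff q) k + sh (sh (coeff q)) k
coeff-[X-1]²*ₚ q k = ≈-trans (coeff-quadratic*ₚ _ _ _ q k) (≈-trans
  -- These coefficients are closed rational sequences, which compute to 1, -2 and 1.
  (+-cong (*-congʳ (pointwise {y = ↑ 1} λ _ → refl))
    (+-cong (*-congʳ (pointwise {y = - ↑ 2} λ _ → refl)) (*-congʳ (pointwise {y = ↑ 1} λ _ → refl))))
  (solve 3 (λ x y z → :n 1 :* x :+ ((:- :n 2) :* y :+ :n 1 :* z) := x :- :n 2 :* y :+ z) ≈-refl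
    (coeff q k) (sh (coeff q) k) (sh (sh (coeff q)) k)))

coeff-X[X-1]*ₚ : ∀ q k → coeff (X *ₚ (X -ₚ const 1ℝ) *ₚ q) k ≈ sh (sh (coeff q)) k - sh (coeff q) k
coeff-X[X-1]*ₚ q k = ≈-trans (coeff-quadratic*ₚ _ _ _ q k) (≈-trans
  (+-cong (*-congʳ (pointwise {y = ↑ 0} λ _ → refl))
    (+-cong (*-congʳ (pointwise {y = - ↑ 1} λ _ → refl)) (*-congʳ (pointwise {y = ↑ 1} λ _ → refl))))
  (solve 3 (λ x y z → :n 0 :* x :+ ((:- :n 1) :* y :+ :n 1 :* z) := z :- y) ≈-refl
    (coeff q k) (sh (coeff q) k) (sh (sh (coeff q)) k)))

coeff-deriv : ∀ p k → coeff (deriv p) k ≈ ↑ suc k * coeff p (suc k)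
coeff-deriv []      k       = ≈-sym (zeroʳ _)
coeff-deriv (a ∷ p) k       = ≈-trans (coeff-+ p (0ℝ ∷ deriv p) k)
  (≈-trans (+-cong ≈-refl (coeff-0∷ (deriv p) k)) (leibniz k))
  where
  leibniz : ∀ k → coeff p k + sh (coeff (deriv p)) k ≈ ↑ suc k * coeff p k
  leibniz zero    = solve 1 (λ x → x :+ :n 0 := :n 1 :* x) ≈-refl (coeff p 0)
  leibniz (suc k) = begin
    coeff p (suc k) + coeff (deriv p) k            ≈⟨ +-cong ≈-refl (coeff-deriv p k) ⟩
    coeff p (suc k) + ↑ suc k * coeff p (suc k)    ≈⟨ solve 2 (λ x n → x :+ n :* x := (n :+ :n 1) :* x) ≈-refl (coeff p (suc k)) (↑ suc k) ⟩
    (↑ suc k + ↑ 1) * coeff p (suc k)              ≈⟨ *-congʳ (↑-suc (suc k)) ⟨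
    ↑ suc (suc k) * coeff p (suc k)                ∎

-- The factor x in x p′ undoes the index shift of differentiation; at k = 0 both sides vanish.
sh-deriv : ∀ p k → sh (coeff (deriv p)) k ≈ ↑ k * coeff p k
sh-deriv p zero    = solve 1 (λ x → :n 0 := :n 0 :* x) ≈-refl (coeff p 0)
sh-deriv p (suc k) = coeff-deriv p k

sh-sh-deriv : ∀ p k → sh (sh (coeff (deriv p))) k ≈ (↑ k - ↑ 1) * sh (coeff p) k
-- A factor 1 is inserted to play the role of `a` in `sh-weighted`.
sh-sh-deriv p k = ≈-trans (solve 1 (λ x → x := :n 1 :* x) ≈-refl _)
  (sh-weighted (λ κ → κ) (λ eq → eq)
    (λ j → ≈-trans (solve 1 (λ x → :n 1 :* x := x) ≈-refl _) (sh-deriv p j)) k)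

-- The right side of the recurrence, with its four scalars kept abstract so that the quotients stay
-- opaque.
coeff-recurrence : ∀ c d e h p q k →
  coeff ((c · X +ₚ const d) *ₚ p
          -ₚ e · ((X -ₚ const 1ℝ) *ₚ (X -ₚ const 1ℝ) *ₚ q)
          -ₚ h · (X *ₚ (X -ₚ const 1ℝ) *ₚ deriv p)) k ≈
  (d * coeff p k + c * sh (coeff p) k)
    - e * (coeff q k - ↑ 2 * sh (coeff q) k + sh (sh (coeff q)) k)
    - h * ((↑ k - ↑ 1) * sh (coeff p) k - ↑ k * coeff p k)
coeff-recurrence c d e h p q k =
  ≈-trans (coeff-minus (P -ₚ e · Q) (h · R) k) (minus-cong
    (≈-trans (coeff-minus P (e · Q) k) (minus-cong
      (≈-trans (coeff-linear*ₚ (c * 0ℝ + d) (c * 1ℝ) p k)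
        (+-cong (*-congʳ c0+d≈d) (*-congʳ (*-identityʳ c))))
      (≈-trans (coeff-· e Q k) (*-congˡ (coeff-[X-1]²*ₚ q k)))))
    (≈-trans (coeff-· h R k) (*-congˡ
      (≈-trans (coeff-X[X-1]*ₚ (deriv p) k) (minus-cong (sh-sh-deriv p k) (sh-deriv p k))))))
  where
  P Q R : Poly
  P = (c · X +ₚ const d) *ₚ p
  Q = (X -ₚ const 1ℝ) *ₚ (X -ₚ const 1ℝ) *ₚ q
  R = X *ₚ (X -ₚ const 1ℝ) *ₚ deriv p
  c0+d≈d : c * 0ℝ + d ≈ d
  c0+d≈d = ≈-trans (+-cong (zeroʳ c) ≈-refl) (+-identityˡ d)

-- Binomial coefficients: Pascal's rule and absorption.

bin : ℕ → ℕ → ℝ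
bin n k = ↑ (n C k)

pascal : ∀ n k → bin (suc n) k ≈ sh (bin n) k + bin n k
pascal n zero    = pointwise λ _ → refl
pascal n (suc k) = ≈-trans (fromℤ-cong (cong +_ (≡.sym (nCk+nC[k+1]≡[n+1]C[k+1] n k))))
  (fromℤ-homo-+ (+ (n C k)) (+ (n C suc k)))

bin-vanishes : ∀ {n k} → n ℕ.< k → bin n k ≈ ↑ 0
bin-vanishes n<k = fromℤ-cong (cong +_ (k>n⇒nCk≡0 n<k))

absorption : ∀ n k → ↑ suc n * sh (bin n) k ≈ ↑ k * bin (suc n) k
absorption zero zero          = pointwise λ _ → refl
absorption zero (suc zero)    = pointwise λ _ → refl
absorption zero (suc (suc k)) = ≈-trans (*-congˡ (bin-vanishes {0} {suc k} (s≤s z≤n)))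
  (≈-trans (solve 1 (λ κ → :n 1 :* :n 0 := κ :* :n 0) ≈-refl (↑ suc (suc k)))
    (*-congˡ (≈-sym (bin-vanishes {1} {suc (suc k)} (s≤s (s≤s z≤n))))))
-- Adding the induction hypotheses at k and k - 1 yields n C(n,k-1) on the left by Pascal.
absorption (suc n) k = begin
  ↑ suc (suc n) * s                             ≈⟨ *-congʳ (↑-suc (suc n)) ⟩
  (↑ suc n + ↑ 1) * s                           ≈⟨ solve 2 (λ ν s → (ν :+ :n 1) :* s := ν :* s :+ s) ≈-refl (↑ suc n) s ⟩
  ↑ suc n * s + s                               ≈⟨ +-cong (*-congˡ s≈) ≈-refl ⟩
  ↑ suc n * (sh (sh (bin n)) k + sh (bin n) k) + s
    ≈⟨ solve 4 (λ ν x y s → ν :* (x :+ y) :+ s := ν :* x :+ ν :* y :+ s) ≈-refl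
         (↑ suc n) (sh (sh (bin n)) k) (sh (bin n) k) s ⟩
  ↑ suc n * sh (sh (bin n)) k + ↑ suc n * sh (bin n) k + s
    ≈⟨ +-cong (+-cong (sh-weighted (λ κ → κ) (λ eq → eq) (absorption n) k) (absorption n k)) ≈-refl ⟩
  (↑ k - ↑ 1) * s + ↑ k * bin (suc n) k + s
    ≈⟨ solve 3 (λ κ s b → (κ :- :n 1) :* s :+ κ :* b :+ s := κ :* (s :+ b)) ≈-refl (↑ k) s (bin (suc n) k) ⟩
  ↑ k * (s + bin (suc n) k)                     ≈⟨ *-congˡ (pascal (suc n) k) ⟨
  ↑ k * bin (suc (suc n)) k                     ∎
  where
  s : ℝ
  s = sh (bin (suc n)) k
  s≈ : s ≈ sh (sh (bin n)) k + sh (bin n) k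
  s≈ = ≈-trans (sh-cong (pascal n) k) (sh-+ (sh (bin n)) (bin n) k)

-- Obtained by subtracting `absorption` from n + 1 times Pascal's rule. With real subtraction it
-- needs no bound on k.
absorption′ : ∀ n k → ↑ suc n * bin n k ≈ (↑ suc n - ↑ k) * bin (suc n) k
absorption′ n k = begin
  ν * b                                ≈⟨ solve 3 (λ ν s b → ν :* b := ν :* (s :+ b) :- ν :* s) ≈-refl ν s b ⟩
  ν * (s + b) - ν * s                  ≈⟨ minus-cong (*-congˡ (≈-sym (pascal n k))) (absorption n k) ⟩
  ν * bin (suc n) k - ↑ k * bin (suc n) k
    ≈⟨ solve 3 (λ ν κ b → ν :* b :- κ :* b := (ν :- κ) :* b) ≈-refl ν (↑ k) (bin (suc n) k) ⟩
  (ν - ↑ k) * bin (suc n) k            ∎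
  where
  ν s b : ℝ
  ν = ↑ suc n
  s = sh (bin n) k
  b = bin n k

-- Coefficients of the Narayana polynomials and of F.

coeff-applyUpTo : ∀ (c : ℕ → ℝ) n → (∀ k → n ≤ k → c k ≈ ↑ 0) → ∀ k → coeff (applyUpTo c n) k ≈ c k
coeff-applyUpTo c zero    vanish k       = ≈-sym (≈-trans (vanish k z≤n) 0≈)
coeff-applyUpTo c (suc n) vanish zero    = ≈-refl
coeff-applyUpTo c (suc n) vanish (suc k) =
  coeff-applyUpTo (λ j → c (suc j)) n (λ j n≤j → vanish (suc j) (s≤s n≤j)) k

coeff-N-B : ∀ n k → coeff (N-B n) k ≈ bin n k * bin n k
coeff-N-B n k = ≈-trans (coeff-applyUpTo (λ j → ↑ ((n C j) ℕ.^ 2)) (suc n)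
    (λ j n<j → ≈-trans (square j) (≈-trans (*-congʳ (bin-vanishes n<j))
      (solve 1 (λ b → :n 0 :* b := :n 0) ≈-refl (bin n j)))) k)
  (square k)
  where
  square : ∀ j → ↑ ((n C j) ℕ.^ 2) ≈ bin n j * bin n j
  -- The power `x ^ 2` unfolds to `x * (x * 1)`.
  square j = ≈-trans (fromℤ-cong (cong (λ c → + ((n C j) ℕ.* c)) (ℕₚ.*-identityʳ (n C j))))
    (↑-* (n C j) (n C j))

coeff-N-A : ∀ n k → ↑ suc n * coeff (N-A n) k ≈ bin (suc n) k * bin (suc n) (suc k)
coeff-N-A n k = begin
  ↑ suc n * coeff (N-A n) k          ≈⟨ *-congˡ (coeff-· (1ℝ / ↑ suc n) (∑≤ n c) k) ⟩
  ↑ suc n * (1ℝ / ↑ suc n * coeff (∑≤ n c) k)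
    ≈⟨ solve 4 (λ ν o i x → ν :* (o :* i :* x) := (ν :* i) :* (o :* x)) ≈-refl (↑ suc n) 1ℝ ((↑ suc n) ⁻¹) (coeff (∑≤ n c) k) ⟩
  (↑ suc n * (↑ suc n) ⁻¹) * (1ℝ * coeff (∑≤ n c) k)
    ≈⟨ *-cong (⁻¹-inverseʳ (↑ suc n)) (*-identityˡ _) ⟩
  1ℝ * coeff (∑≤ n c) k              ≈⟨ *-identityˡ _ ⟩
  coeff (∑≤ n c) k                   ≈⟨ coeff-applyUpTo c (suc n) (λ j n<j → ≈-trans (product j)
    (≈-trans (*-congˡ (bin-vanishes (s≤s n<j))) (solve 1 (λ b → b :* :n 0 := :n 0) ≈-refl (bin (suc n) j)))) k ⟩
  c k                                ≈⟨ product k ⟩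
  bin (suc n) k * bin (suc n) (suc k) ∎
  where
  c : ℕ → ℝ
  c k = ↑ ((suc n C k) ℕ.* (suc n C suc k))
  product : ∀ j → c j ≈ bin (suc n) j * bin (suc n) (suc j)
  product j = ↑-* (suc n C j) (suc n C suc j)

-- The factor x aligns the two binomials as C(n+1,k-1) and C(n+1,k), each of which absorbs into
-- C(n+2,k).
sh-N-A : ∀ n k → ↑ suc n * sh (coeff (N-A n)) k ≈ sh (bin (suc n)) k * bin (suc n) k
sh-N-A n zero    = solve 2 (λ ν b → ν :* :n 0 := :n 0 :* b) ≈-refl (↑ suc n) (bin (suc n) 0)
sh-N-A n (suc k) = coeff-N-A n k

-- Includes degree 1, where the filler F α β 1 = [] fits because both sides vanish.
coeff-F : ∀ α β n k → ↑ suc n * (↑ suc n - ↑ 1) * coeff (F α β (suc n)) k ≈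
                      G α β (↑ suc n) (↑ k) * (bin (suc n) k * bin (suc n) k)
coeff-F α β zero k = begin
  ↑ 1 * (↑ 1 - ↑ 1) * 0ℝ    ≈⟨ solve 1 (λ z → :n 1 :* (:n 1 :- :n 1) :* z := :n 0) ≈-refl 0ℝ ⟩
  ↑ 0                       ≈⟨ solve 1 (λ β → :n 0 := β :* :n 0) ≈-refl β ⟩
  β * ↑ 0                   ≈⟨ *-congˡ (disjoint k) ⟨
  β * (sh (bin 0) k * bin 0 k)
    ≈⟨ solve 3 (λ β x y → β :* (x :* y) := β :* ((:n 1 :* x) :* (:n 1 :* y))) ≈-refl β (sh (bin 0) k) (bin 0 k) ⟩
  β * ((↑ 1 * sh (bin 0) k) * (↑ 1 * bin 0 k))
    -- Absorption turns the zero product into k(1-k) C(1,k)², the β part of `G` at degree 1; the α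
    -- part has the factor 1 - 1.
    ≈⟨ *-congˡ (*-cong (absorption 0 k) (absorption′ 0 k)) ⟩
  β * ((↑ k * bin 1 k) * ((↑ 1 - ↑ k) * bin 1 k))
    ≈⟨ solve 4 (λ α β κ b → β :* ((κ :* b) :* ((:n 1 :- κ) :* b)) := :G α β (:n 1) κ :* (b :* b)) ≈-refl α β (↑ k) (bin 1 k) ⟩
  G α β (↑ 1) (↑ k) * (bin 1 k * bin 1 k) ∎
  where
  disjoint : ∀ k → sh (bin 0) k * bin 0 k ≈ ↑ 0
  disjoint zero    = solve 1 (λ b → :n 0 :* b := :n 0) ≈-refl (bin 0 0)
  disjoint (suc k) = ≈-trans (*-congˡ (bin-vanishes {0} {suc k} (s≤s z≤n))) (solve 1 (λ b → b :* :n 0 := :n 0) ≈-refl (bin 0 k))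
coeff-F α β (suc m) k = begin
  ν * (ν - ↑ 1) * coeff (F α β n) k
    ≈⟨ *-congˡ (≈-trans (coeff-+ (α · N-B n) ((β * ν) · (X *ₚ N-A m)) k) (+-cong
         (≈-trans (coeff-· α (N-B n) k) (*-congˡ (coeff-N-B n k)))
         (≈-trans (coeff-· (β * ν) (X *ₚ N-A m) k) (*-congˡ (coeff-X*ₚ (N-A m) k))))) ⟩
  ν * (ν - ↑ 1) * (α * (b * b) + β * ν * S)
    ≈⟨ solve 5 (λ α β ν b S → ν :* (ν :- :n 1) :* (α :* (b :* b) :+ β :* ν :* S) :=
         ν :* (ν :- :n 1) :* α :* (b :* b) :+ β :* (ν :* ν :* ((ν :- :n 1) :* S))) ≈-refl α β ν b S ⟩
  ν * (ν - ↑ 1) * α * (b * b) + β * (ν * ν * ((ν - ↑ 1) * S))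
    -- The factor ν - 1 cancels the denominator of `N-A m`; the remaining ν² then gives one ν to
    -- each binomial for absorption.
    ≈⟨ +-cong ≈-refl (*-congˡ (*-congˡ (≈-trans (*-congʳ (≈-sym (↑-pred (suc m)))) (sh-N-A m k)))) ⟩
  ν * (ν - ↑ 1) * α * (b * b) + β * (ν * ν * (u * w))
    ≈⟨ +-cong ≈-refl (*-congˡ (solve 3 (λ ν u w → ν :* ν :* (u :* w) := (ν :* u) :* (ν :* w)) ≈-refl ν u w)) ⟩
  ν * (ν - ↑ 1) * α * (b * b) + β * ((ν * u) * (ν * w))
    ≈⟨ +-cong ≈-refl (*-congˡ (*-cong (absorption (suc m) k) (absorption′ (suc m) k))) ⟩
  ν * (ν - ↑ 1) * α * (b * b) + β * ((↑ k * b) * ((ν - ↑ k) * b))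
    ≈⟨ solve 5 (λ α β ν κ b → ν :* (ν :- :n 1) :* α :* (b :* b) :+ β :* ((κ :* b) :* ((ν :- κ) :* b)) :=
         :G α β ν κ :* (b :* b)) ≈-refl α β ν (↑ k) b ⟩
  G α β ν (↑ k) * (b * b) ∎
  where
  n : ℕ
  n = suc (suc m)
  ν b S u w : ℝ
  ν = ↑ n
  b = bin n k
  S = sh (coeff (N-A m)) k
  u = sh (bin (suc m)) k
  w = bin (suc m) k

-- Passing to a common squared binomial.

sh-square : ∀ f k → sh (λ j → f j * f j) k ≈ sh f k * sh f k
sh-square f zero    = solve 0 (:n 0 := :n 0 :* :n 0) ≈-refl
sh-square f (suc k) = ≈-refl

-- Squaring a x = b y trades the binomial x of a coefficient formula for the common binomial y, at
-- the cost of a factor a².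
transfer : ∀ {a b c f h x y} → a * x ≈ b * y → c * f ≈ h * (x * x) →
           a * a * (c * f) ≈ h * (b * b * (y * y))
transfer {a} {b} {c} {f} {h} {x} {y} ax≈by cf≈hx² = begin
  a * a * (c * f)           ≈⟨ *-congˡ cf≈hx² ⟩
  a * a * (h * (x * x))     ≈⟨ solve 3 (λ a h x → a :* a :* (h :* (x :* x)) := h :* ((a :* x) :* (a :* x))) ≈-refl a h x ⟩
  h * ((a * x) * (a * x))   ≈⟨ *-congˡ (*-cong ax≈by ax≈by) ⟩
  h * ((b * y) * (b * y))   ≈⟨ solve 3 (λ h b y → h :* ((b :* y) :* (b :* y)) := h :* (b :* b :* (y :* y))) ≈-refl h b y ⟩
  h * (b * b * (y * y))     ∎

-- Coefficients of F at degree n - 1 lie two absorptions below C(n+1,k).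
chain : ∀ {a b c d x y z} → a * x ≈ b * y → c * y ≈ d * z → (c * a) * x ≈ (b * d) * z
chain {a} {b} {c} {d} {x} {y} {z} ax≈by cy≈dz = begin
  (c * a) * x   ≈⟨ *-assoc c a x ⟩
  c * (a * x)   ≈⟨ *-congˡ ax≈by ⟩
  c * (b * y)   ≈⟨ solve 3 (λ c b y → c :* (b :* y) := b :* (c :* y)) ≈-refl c b y ⟩
  b * (c * y)   ≈⟨ *-congˡ cy≈dz ⟩
  b * (d * z)   ≈⟨ *-assoc b d z ⟨
  (b * d) * z   ∎

-- The recurrence at x^k without denominators, for n = m + 2.

module Cleared (α β : ℝ) (m k : ℕ) where

  n : ℕ
  n = suc (suc m)

  ν κ r q : ℝ
  ν = ↑ n
  κ = ↑ k
  r = bin (suc n) k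
  q = r * r

  f₀ f₁ g₀ g₁ g₂ : ℝ
  f₀ = coeff (F α β n) k
  f₁ = sh (coeff (F α β n)) k
  g₀ = coeff (F α β (suc m)) k
  g₁ = sh (coeff (F α β (suc m))) k
  g₂ = sh (sh (coeff (F α β (suc m)))) k

  t-r : (ν + ↑ 1) * bin n k ≈ (ν + ↑ 1 - κ) * r
  t-r = ≈-trans (*-congʳ (≈-sym (↑-suc n)))
    (≈-trans (absorption′ n k) (*-congʳ (minus-cong (↑-suc n) ≈-refl)))

  s-r : (ν + ↑ 1) * sh (bin n) k ≈ κ * r
  s-r = ≈-trans (*-congʳ (≈-sym (↑-suc n))) (absorption n k)

  F₊-r : (ν + ↑ 1) * (ν + ↑ 1 - ↑ 1) * coeff (F α β (suc n)) k ≈ G α β (ν + ↑ 1) κ * q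
  F₊-r = ≈-trans (*-congʳ (*-cong (≈-sym (↑-suc n)) (minus-cong (≈-sym (↑-suc n)) ≈-refl)))
    (≈-trans (coeff-F α β n k) (*-congʳ (G-cong α β (↑-suc n) ≈-refl)))

  f₀-r : (ν + ↑ 1) * (ν + ↑ 1) * (ν * (ν - ↑ 1) * f₀) ≈
         G α β ν κ * ((ν + ↑ 1 - κ) * (ν + ↑ 1 - κ) * q)
  f₀-r = transfer t-r (coeff-F α β (suc m) k)

  f₁-r : (ν + ↑ 1) * (ν + ↑ 1) * (ν * (ν - ↑ 1) * f₁) ≈ G α β ν (κ - ↑ 1) * (κ * κ * q)
  f₁-r = transfer s-r (≈-trans
    (sh-weighted (G α β ν) (G-cong α β ≈-refl) (coeff-F α β (suc m)) k)
    (*-congˡ (sh-square (bin n) k)))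

  -- For n = 2 this rests on the degree 1 case of `coeff-F`, where the prefactor (n-1)(n-2) is zero.
  F₋ : ∀ j → (ν - ↑ 1) * (ν - ↑ 1 - ↑ 1) * coeff (F α β (suc m)) j ≈
             G α β (ν - ↑ 1) (↑ j) * (bin (suc m) j * bin (suc m) j)
  F₋ j = ≈-trans (*-congʳ (*-cong (≈-sym (↑-pred (suc m))) (minus-cong (≈-sym (↑-pred (suc m))) ≈-refl)))
    (≈-trans (coeff-F α β m j) (*-congʳ (G-cong α β (↑-pred (suc m)) ≈-refl)))

  sh-F₋ : ∀ j → (ν - ↑ 1) * (ν - ↑ 1 - ↑ 1) * sh (coeff (F α β (suc m))) j ≈
                G α β (ν - ↑ 1) (↑ j - ↑ 1) * (sh (bin (suc m)) j * sh (bin (suc m)) j)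
  sh-F₋ j = ≈-trans (sh-weighted (G α β (ν - ↑ 1)) (G-cong α β ≈-refl) F₋ j)
    (*-congˡ (sh-square (bin (suc m)) j))

  g₀-r : ((ν + ↑ 1) * ν) * ((ν + ↑ 1) * ν) * ((ν - ↑ 1) * (ν - ↑ 1 - ↑ 1) * g₀) ≈
         G α β (ν - ↑ 1) κ * (((ν - κ) * (ν + ↑ 1 - κ)) * ((ν - κ) * (ν + ↑ 1 - κ)) * q)
  g₀-r = transfer (chain (absorption′ (suc m) k) t-r) (F₋ k)

  g₁-r : ((ν + ↑ 1) * ν) * ((ν + ↑ 1) * ν) * ((ν - ↑ 1) * (ν - ↑ 1 - ↑ 1) * g₁) ≈
         G α β (ν - ↑ 1) (κ - ↑ 1) * ((κ * (ν + ↑ 1 - κ)) * (κ * (ν + ↑ 1 - κ)) * q)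
  g₁-r = transfer (chain (absorption (suc m) k) t-r) (sh-F₋ k)

  g₂-r : ((ν + ↑ 1) * ν) * ((ν + ↑ 1) * ν) * ((ν - ↑ 1) * (ν - ↑ 1 - ↑ 1) * g₂) ≈
         G α β (ν - ↑ 1) (κ - ↑ 1 - ↑ 1) * (((κ - ↑ 1) * κ) * ((κ - ↑ 1) * κ) * q)
  g₂-r = transfer
    -- The route is C(n-1,k-2), C(n,k-1), C(n+1,k).
    (chain (sh-weighted (λ x → x) (λ eq → eq) (absorption (suc m)) k) s-r)
    (≈-trans (sh-weighted (λ x → G α β (ν - ↑ 1) (x - ↑ 1))
                (λ eq → G-cong α β ≈-refl (minus-cong eq ≈-refl)) sh-F₋ k)
      (*-congˡ (sh-square (sh (bin (suc m))) k)))

  -- The prefactor of `f₀` and `f₁` in `f₀-r` and `f₁-r`. The one of `g₀`, `g₁`, `g₂` is K n (n-2),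
  -- and `rhs` supplies n (n-2), so nothing is ever divided by n - 2.
  K : ℝ
  K = (ν - ↑ 1) * ν * ((ν + ↑ 1) * (ν + ↑ 1))

  -- The coefficient of x^k on the right of the recurrence, times n (n+1) T₁.
  rhs : ℝ
  rhs = ↑ 2 * (ν * (ν + ↑ 1)) * T₂ α β n * f₁ + ↑ 2 * ν * (ν - ↑ 1) * T₅ α β n * f₀
        - ν * (ν - ↑ 2) * T₃ α β n * (g₀ - ↑ 2 * g₁ + g₂)
        - ↑ 2 * T₄ α β n * ((κ - ↑ 1) * f₁ - κ * f₀)

  -- Equals K `rhs` once its arguments are the left sides of `f₀-r` to `g₂-r`; the factor n (n-2) of
  -- the `T₃` term sits inside the last three.
  combine : ℝ → ℝ → ℝ → ℝ → ℝ → ℝ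
  combine x₀ x₁ y₀ y₁ y₂ =
    (↑ 2 * ν * (ν - ↑ 1) * T₅ α β n + ↑ 2 * T₄ α β n * κ) * x₀
    + (↑ 2 * (ν * (ν + ↑ 1)) * T₂ α β n - ↑ 2 * T₄ α β n * (κ - ↑ 1)) * x₁
    - T₃ α β n * (y₀ - ↑ 2 * y₁ + y₂)

  combine-cong : ∀ {x₀ x₀′ x₁ x₁′ y₀ y₀′ y₁ y₁′ y₂ y₂′} →
    x₀ ≈ x₀′ → x₁ ≈ x₁′ → y₀ ≈ y₀′ → y₁ ≈ y₁′ → y₂ ≈ y₂′ →
    combine x₀ x₁ y₀ y₁ y₂ ≈ combine x₀′ x₁′ y₀′ y₁′ y₂′
  combine-cong a b c d e = minus-cong (+-cong (*-congˡ a) (*-congˡ b))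
    (*-congˡ (+-cong (minus-cong c (*-congˡ d)) e))

  -- With `q` as an independent variable this is a polynomial identity in α, β, n, k and q, of
  -- degree 2 in α and β; normalisation proves it.
  identity : K * T₁ α β n * (G α β (ν + ↑ 1) κ * q) ≈ combine
    (G α β ν κ * ((ν + ↑ 1 - κ) * (ν + ↑ 1 - κ) * q))
    (G α β ν (κ - ↑ 1) * (κ * κ * q))
    (G α β (ν - ↑ 1) κ * (((ν - κ) * (ν + ↑ 1 - κ)) * ((ν - κ) * (ν + ↑ 1 - κ)) * q))
    (G α β (ν - ↑ 1) (κ - ↑ 1) * ((κ * (ν + ↑ 1 - κ)) * (κ * (ν + ↑ 1 - κ)) * q))
    (G α β (ν - ↑ 1) (κ - ↑ 1 - ↑ 1) * (((κ - ↑ 1) * κ) * ((κ - ↑ 1) * κ) * q))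
  identity = solve 5 (λ α β n k q →
      (n :- :n 1) :* n :* ((n :+ :n 1) :²) :* :T₁ α β n :* (:G α β (n :+ :n 1) k :* q)
      :=
      (:n 2 :* n :* (n :- :n 1) :* :T₅ α β n :+ :n 2 :* :T₄ α β n :* k)
         :* (:G α β n k :* ((n :+ :n 1 :- k) :² :* q))
      :+ (:n 2 :* (n :* (n :+ :n 1)) :* :T₂ α β n :- :n 2 :* :T₄ α β n :* (k :- :n 1))
         :* (:G α β n (k :- :n 1) :* (k :² :* q))
      :- :T₃ α β n :*
         (:G α β (n :- :n 1) k :* (((n :- k) :* (n :+ :n 1 :- k)) :² :* q)
          :- :n 2 :* (:G α β (n :- :n 1) (k :- :n 1) :* ((k :* (n :+ :n 1 :- k)) :² :* q))
          :+ :G α β (n :- :n 1) (k :- :n 1 :- :n 1) :* (((k :- :n 1) :* k) :² :* q)))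
    ≈-refl α β ν κ q

  cleared : K * (ν * (ν + ↑ 1) * (T₁ α β n * coeff (F α β (suc n)) k)) ≈ K * rhs
  cleared = begin
    K * (ν * (ν + ↑ 1) * (T₁ α β n * F₊))
      ≈⟨ solve 4 (λ K n t f → K :* (n :* (n :+ :n 1) :* (t :* f)) :=
           K :* t :* ((n :+ :n 1) :* (n :+ :n 1 :- :n 1) :* f)) ≈-refl K ν (T₁ α β n) F₊ ⟩
    K * T₁ α β n * ((ν + ↑ 1) * (ν + ↑ 1 - ↑ 1) * F₊)
      ≈⟨ *-congˡ F₊-r ⟩
    K * T₁ α β n * (G α β (ν + ↑ 1) κ * q)
      ≈⟨ identity ⟩
    combine _ _ _ _ _
      ≈⟨ combine-cong f₀-r f₁-r g₀-r g₁-r g₂-r ⟨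
    combine _ _ _ _ _
      ≈⟨ solve 11 (λ n κ t₂ t₃ t₄ t₅ f₀ f₁ g₀ g₁ g₂ →
           (:n 2 :* n :* (n :- :n 1) :* t₅ :+ :n 2 :* t₄ :* κ) :* ((n :+ :n 1) :² :* (n :* (n :- :n 1) :* f₀))
           :+ (:n 2 :* (n :* (n :+ :n 1)) :* t₂ :- :n 2 :* t₄ :* (κ :- :n 1)) :* ((n :+ :n 1) :² :* (n :* (n :- :n 1) :* f₁))
           :- t₃ :* (((n :+ :n 1) :* n) :² :* ((n :- :n 1) :* (n :- :n 1 :- :n 1) :* g₀)
             :- :n 2 :* (((n :+ :n 1) :* n) :² :* ((n :- :n 1) :* (n :- :n 1 :- :n 1) :* g₁))
             :+ ((n :+ :n 1) :* n) :² :* ((n :- :n 1) :* (n :- :n 1 :- :n 1) :* g₂))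
           := (n :- :n 1) :* n :* ((n :+ :n 1) :²) :*
             (:n 2 :* (n :* (n :+ :n 1)) :* t₂ :* f₁ :+ :n 2 :* n :* (n :- :n 1) :* t₅ :* f₀
              :- n :* (n :- :n 2) :* t₃ :* (g₀ :- :n 2 :* g₁ :+ g₂)
              :- :n 2 :* t₄ :* ((κ :- :n 1) :* f₁ :- κ :* f₀)))
         ≈-refl ν κ (T₂ α β n) (T₃ α β n) (T₄ α β n) (T₅ α β n) f₀ f₁ g₀ g₁ g₂ ⟩
    K * rhs ∎
    where
    F₊ : ℝ
    F₊ = coeff (F α β (suc n)) k

  cleared-F₊ : ↑ n * ↑ suc n * T₁ α β n * coeff (F α β (suc n)) k ≈ rhs
  -- This is `K` rewritten with factors of the form `↑ suc _`, for which instance search finds that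
  -- the product is nonzero.
  cleared-F₊ = *-cancelˡ (↑ suc m * ↑ n * (↑ suc n * ↑ suc n)) (begin
    K′ * (↑ n * ↑ suc n * T₁ α β n * F₊)         ≈⟨ *-congˡ (*-assoc (↑ n * ↑ suc n) (T₁ α β n) F₊) ⟩
    K′ * (↑ n * ↑ suc n * (T₁ α β n * F₊))       ≈⟨ *-cong K′≈K (*-congʳ (*-congˡ (↑-suc n))) ⟩
    K * (ν * (ν + ↑ 1) * (T₁ α β n * F₊))        ≈⟨ cleared ⟩
    K * rhs                                      ≈⟨ *-congʳ K′≈K ⟨
    K′ * rhs                                     ∎)
    where
    F₊ K′ : ℝ
    F₊ = coeff (F α β (suc n)) k
    K′ = ↑ suc m * ↑ n * (↑ suc n * ↑ suc n)
    K′≈K : K′ ≈ K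
    K′≈K = *-cong (*-congʳ (↑-pred (suc m))) (*-cong (↑-suc n) (↑-suc n))

  -- The three reciprocals are variables known only through their defining equations, which lets the
  -- solver handle the quotients.
  divided : ∀ z₁ z₂ z₃ →
    T₁ α β n * z₁ ≈ 1ℝ → ↑ suc n * T₁ α β n * z₂ ≈ 1ℝ → ↑ n * ↑ suc n * T₁ α β n * z₃ ≈ 1ℝ →
    ↑ n * ↑ suc n * T₁ α β n *
      ((↑ 2 * (↑ n - ↑ 1) * T₅ α β n * z₂ * f₀ + ↑ 2 * T₂ α β n * z₁ * f₁)
        - (↑ n - ↑ 2) * T₃ α β n * z₂ * (g₀ - ↑ 2 * g₁ + g₂)
        - ↑ 2 * T₄ α β n * z₃ * ((κ - ↑ 1) * f₁ - κ * f₀)) ≈ rhs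
  divided z₁ z₂ z₃ e₁ e₂ e₃ = begin
    ν * p * t₁ *
      ((↑ 2 * (ν - ↑ 1) * t₅ * z₂ * f₀ + ↑ 2 * t₂ * z₁ * f₁) - (ν - ↑ 2) * t₃ * z₂ * g - ↑ 2 * t₄ * z₃ * h)
      ≈⟨ solve 14 (λ n p t₁ t₂ t₃ t₄ t₅ z₁ z₂ z₃ f₀ f₁ g h →
           n :* p :* t₁ :* ((:n 2 :* (n :- :n 1) :* t₅ :* z₂ :* f₀ :+ :n 2 :* t₂ :* z₁ :* f₁)
             :- (n :- :n 2) :* t₃ :* z₂ :* g :- :n 2 :* t₄ :* z₃ :* h)
           := (t₁ :* z₁) :* (:n 2 :* (n :* p) :* t₂ :* f₁) :+ (p :* t₁ :* z₂) :* (:n 2 :* n :* (n :- :n 1) :* t₅ :* f₀)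
             :- (p :* t₁ :* z₂) :* (n :* (n :- :n 2) :* t₃ :* g) :- (n :* p :* t₁ :* z₃) :* (:n 2 :* t₄ :* h))
         ≈-refl ν p t₁ t₂ t₃ t₄ t₅ z₁ z₂ z₃ f₀ f₁ g h ⟩
    (t₁ * z₁) * (↑ 2 * (ν * p) * t₂ * f₁) + (p * t₁ * z₂) * (↑ 2 * ν * (ν - ↑ 1) * t₅ * f₀)
      - (p * t₁ * z₂) * (ν * (ν - ↑ 2) * t₃ * g) - (ν * p * t₁ * z₃) * (↑ 2 * t₄ * h)
      ≈⟨ minus-cong (minus-cong (+-cong (unit e₁) (unit e₂)) (unit e₂)) (unit e₃) ⟩
    ↑ 2 * (ν * p) * t₂ * f₁ + ↑ 2 * ν * (ν - ↑ 1) * t₅ * f₀ - ν * (ν - ↑ 2) * t₃ * g - ↑ 2 * t₄ * h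
      ≈⟨ minus-cong (minus-cong (+-cong
           (*-congʳ (*-congʳ (*-congˡ (*-congˡ (↑-suc n))))) ≈-refl) ≈-refl) ≈-refl ⟩
    rhs ∎
    where
    p t₁ t₂ t₃ t₄ t₅ g h : ℝ
    p  = ↑ suc n
    t₁ = T₁ α β n
    t₂ = T₂ α β n
    t₃ = T₃ α β n
    t₄ = T₄ α β n
    t₅ = T₅ α β n
    g  = g₀ - ↑ 2 * g₁ + g₂
    h  = (κ - ↑ 1) * f₁ - κ * f₀
    unit : ∀ {x y} → x ≈ 1ℝ → x * y ≈ y
    unit x≈1 = ≈-trans (*-congʳ x≈1) (*-identityˡ _)

-- The recurrence as an equality of polynomials.

theorem3p1 :
  (α β : ℝ) (n : ℕ) (2≤n : 2 ≤ n) (T₁≠0 : T₁ α β n ≠0) →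
  let instance
        _ : (↑ n) ≠0
        _ = 2≤n⇒↑n≠0 2≤n
        _ : T₁ α β n ≠0
        _ = T₁≠0
  in
  F α β (suc n) ≋
    ( ( ((↑ 2 * T₂ α β n) / T₁ α β n) · X
        +ₚ const ((↑ 2 * (↑ n - ↑ 1) * T₅ α β n) / (↑ suc n * T₁ α β n)) )
      *ₚ F α β n )
    -ₚ ((↑ n - ↑ 2) * T₃ α β n / (↑ suc n * T₁ α β n))
         · ((X -ₚ const 1ℝ) *ₚ (X -ₚ const 1ℝ) *ₚ F α β (n ∸ 1))
    -ₚ (↑ 2 * T₄ α β n / (↑ n * ↑ suc n * T₁ α β n))
         · (X *ₚ (X -ₚ const 1ℝ) *ₚ deriv (F α β n))
theorem3p1 α β n@(suc (suc m)) (s≤s (s≤s _)) T₁≠0 k =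
  -- Both sides agree after multiplication by n (n+1) T₁, which is nonzero and cancels.
  ≈-trans (*-cancelˡ (↑ n * ↑ suc n * T₁ α β n) (≈-trans cleared-F₊ (≈-sym (divided _ _ _
      (⁻¹-inverseʳ (T₁ α β n))
      (⁻¹-inverseʳ (↑ suc n * T₁ α β n))
      (⁻¹-inverseʳ (↑ n * ↑ suc n * T₁ α β n))))))
    (≈-sym (coeff-recurrence _ _ _ _ (F α β n) (F α β (suc m)) k))
  where
  open Cleared α β m k using (cleared-F₊; divided)
  instance
    _ : T₁ α β n ≠0
    _ = T₁≠0
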